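{- Let $\{A^r,A^l,A^{bi}\}$ be a signature and assume that $a\in A^r$ and $b\in A^l$. Suppose furthermore that $B=\emptyset$. Then there is no translation $\mathcal{T}$ from LTSs modulo $\lesssim_{cc}$ into LTSs modulo $\lesssim_B$ (i.e. no map $\mathcal{T}$ sending processes over $A=A^r\cup A^l\cup A^{bi}$ to processes over some set of actions) that satisfies both of the following conditions: (1) for all $p$ and $q$, $p\lesssim_{cc}q$ if and only if $\mathcal{T}(p)\lesssim_B\mathcal{T}(q)$; (2) $\mathcal{T}$ is a homomorphism with respect to $+$, that is, $\mathcal{T}(p+q)=\mathcal{T}(p)+\mathcal{T}(q)$ for all $p,q$.
   Context: A process is an LTS (a set of states with a transition relation labelled by actions) with a distinguished state; it is identified notationally with that state $p$. $p+q$ is the standard nondeterministic composition from CCS, whose transitions from its distinguished state are those of $p$ together with those of $q$ ($p+q\xrightarrow{c}r$ iff $p\xrightarrow{c}r$ or $q\xrightarrow{c}r$). A signature is a partition $\{A^r,A^l,A^{bi}\}$ of a set of actions $A$ into pairwise disjoint, possibly empty sets. $p\lesssim_{cc}q$ iff $p\,R\,q$ for some relation $R$ such that whenever $p\,R\,q$: for all $c\in A^r\cup A^{bi}$ and $p\xrightarrow{c}p'$ there is $q\xrightarrow{c}q'$ with $p'\,R\,q'$; and for all $c\in A^l\cup A^{bi}$ and $q\xrightarrow{c}q'$ there is $p\xrightarrow{c}p'$ with $p'\,R\,q'$. For a subset $B$ of the set of actions (the bisimulation set), $p\lesssim_B q$ iff $p\,R\,q$ for some relation $R$ such that whenever $p\,R\,q$: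 for every action $c$, if $p\xrightarrow{c}p'$ then there is $q\xrightarrow{c}q'$ with $p'\,R\,q'$; and for all $c\in B$, if $q\xrightarrow{c}q'$ then there is $p\xrightarrow{c}p'$ with $p'\,R\,q'$. (For $B=\emptyset$ this is the simulation preorder.) -}

module Defs where

open import Level using (Level) renaming (suc to lsuc)
open import Data.Maybe.Base using (Maybe; just; nothing)
open import Data.Product.Base using (Σ-syntax; ∃-syntax; _×_)
open import Data.Sum.Base using (_⊎_; inj₁; inj₂)
open import Relation.Binary.Construct.Interior.Symmetric using (SymInterior)
open import Relation.Binary.Core using (REL)
open import Relation.Unary using (Pred; Universal; _∈_; _∪_; _⊥_)

private
  variable
    ℓ : Level
    A : Set ℓ

record LTS (A : Set ℓ) : Set (lsuc ℓ) where
  field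
    State : Set ℓ
    _—[_]→_ : State → A → State → Set ℓ

record Process (A : Set ℓ) : Set (lsuc ℓ) where
  field
    lts : LTS A
  open LTS lts public
  field
    init : State

open Process using (State; init)

-- The distinguished state of p + q is the fresh state `nothing`.  The old
-- distinguished states are kept, since they may be reachable in p or in q.
module _ {A : Set ℓ} (p q : Process A) where
  private
    module P = Process p
    module Q = Process q

  data ChoiceStep : Maybe (P.State ⊎ Q.State) → A →
                    Maybe (P.State ⊎ Q.State) → Set ℓ where
    chooseˡ : ∀ {c p′} → P.init P.—[ c ]→ p′ →
              ChoiceStep nothing c (just (inj₁ p′))
    chooseʳ : ∀ {c q′} → Q.init Q.—[ c ]→ q′ →
              ChoiceStep nothing c (just (inj₂ q′))
    insideˡ : ∀ {p₀ c p′} → p₀ P.—[ c ]→ p′ →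
              ChoiceStep (just (inj₁ p₀)) c (just (inj₁ p′))
    insideʳ : ∀ {q₀ c q′} → q₀ Q.—[ c ]→ q′ →
              ChoiceStep (just (inj₂ q₀)) c (just (inj₂ q′))

infixl 6 _+_

_+_ : {A : Set ℓ} → Process A → Process A → Process A
p + q = record
  { lts = record
    { State   = Maybe (State p ⊎ State q)
    ; _—[_]→_ = ChoiceStep p q
    }
  ; init = nothing
  }

record Signature (A : Set ℓ) : Set (lsuc ℓ) where
  field
    Aʳ Aˡ Aᵇⁱ : Pred A ℓ
    r⊥l   : Aʳ ⊥ Aˡ
    r⊥bi  : Aʳ ⊥ Aᵇⁱ
    l⊥bi  : Aˡ ⊥ Aᵇⁱ
    cover : Universal (Aʳ ∪ Aˡ ∪ Aᵇⁱ)

module _ {A : Set ℓ} (p q : Process A) where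
  private
    module P = Process p
    module Q = Process q

  record IsCCSimulation (S : Signature A) (R : REL P.State Q.State ℓ) : Set ℓ where
    open Signature S
    field
      forth : ∀ {s t c s′} → R s t → c ∈ Aʳ ∪ Aᵇⁱ → s P.—[ c ]→ s′ →
              ∃[ t′ ] (t Q.—[ c ]→ t′) × R s′ t′
      back  : ∀ {s t c t′} → R s t → c ∈ Aˡ ∪ Aᵇⁱ → t Q.—[ c ]→ t′ →
              ∃[ s′ ] (s P.—[ c ]→ s′) × R s′ t′

  record IsPartialBisimulation (B : Pred A ℓ) (R : REL P.State Q.State ℓ) : Set ℓ where
    field
      forth : ∀ {s t c s′} → R s t → s P.—[ c ]→ s′ →
              ∃[ t′ ] (t Q.—[ c ]→ t′) × R s′ t′
      back  : ∀ {s t c t′} → R s t → c ∈ B → t Q.—[ c ]→ t′ →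
              ∃[ s′ ] (s P.—[ c ]→ s′) × R s′ t′

infix 4 _≲cc[_]_ _≲[_]_ _≈[_]_

-- Relations at level ℓ suffice: the largest such relation, defined
-- coinductively, already lives at that level.
_≲cc[_]_ : {A : Set ℓ} → Process A → Signature A → Process A → Set (lsuc ℓ)
_≲cc[_]_ {ℓ} p S q =
  Σ[ R ∈ REL (State p) (State q) ℓ ] IsCCSimulation p q S R × R (init p) (init q)

_≲[_]_ : {A : Set ℓ} → Process A → Pred A ℓ → Process A → Set (lsuc ℓ)
_≲[_]_ {ℓ} p B q =
  Σ[ R ∈ REL (State p) (State q) ℓ ] IsPartialBisimulation p q B R × R (init p) (init q)

-- Equality of processes modulo ≲_B.  It is implied by _≡_, by isomorphism and
-- by bisimilarity, so a homomorphism for any of those is one for this.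
_≈[_]_ : {A : Set ℓ} → Process A → Pred A ℓ → Process A → Set (lsuc ℓ)
p ≈[ B ] q = SymInterior (λ p₁ q₁ → p₁ ≲[ B ] q₁) p q

{-# OPTIONS --safe #-}
module Submission where

-- If B is empty then 𝒯 p ≲ 𝒯 p + 𝒯 q ≲ 𝒯 (p + q), so a translation satisfying
-- both conditions forces p ≲cc p + q for all p and q.  This fails when p is
-- inert and q can perform b, as p would have to match the b-step of p + q.

open import Defs
open import Level using (Level)
open import Data.Maybe.Base using (just; nothing)
open import Data.Product.Base using (Σ-syntax; _×_; _,_; proj₁; proj₂)
open import Data.Sum.Base using (inj₁)
open import Data.Unit.Polymorphic.Base using (⊤; tt)
open import Function.Bundles using (_⇔_; Equivalence)
open import Relation.Binary.Construct.Composition using (_;_)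
open import Relation.Binary.Construct.Interior.Symmetric using (SymInterior)
open import Relation.Binary.Core using (REL)
open import Relation.Binary.PropositionalEquality.Core using (refl)
open import Relation.Nullary.Negation.Core using (¬_; contradiction)
open import Relation.Unary using (Pred; Empty; _∈_; _≐_; ∅; ｛_｝)
import Relation.Unary.Polymorphic as Poly

private
  variable
    ℓ : Level
    A : Set ℓ

open Process using (State; init)

≲-trans : {B : Pred A ℓ} (p q r : Process A) →
          p ≲[ B ] q → q ≲[ B ] r → p ≲[ B ] r
≲-trans {B = B} p q r (R , R-sim , Rpq) (T , T-sim , Tqr) =
  (R ; T) , record { forth = forth ; back = back } , init q , Rpq , Tqr
  where
  module R = IsPartialBisimulation R-sim
  module T = IsPartialBisimulation T-sim

  forth : ∀ {s t c s′} → (R ; T) s t → Process._—[_]→_ p s c s′ →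
          Σ[ t′ ∈ State r ] Process._—[_]→_ r t c t′ × (R ; T) s′ t′
  forth (_ , Rsu , Tut) s→s′ with R.forth Rsu s→s′
  ... | u′ , u→u′ , Rs′u′ with T.forth Tut u→u′
  ... | t′ , t→t′ , Tu′t′ = t′ , t→t′ , u′ , Rs′u′ , Tu′t′

  back : ∀ {s t c t′} → (R ; T) s t → c ∈ B → Process._—[_]→_ r t c t′ →
         Σ[ s′ ∈ State p ] Process._—[_]→_ p s c s′ × (R ; T) s′ t′
  back (_ , Rsu , Tut) c∈B t→t′ with T.back Tut c∈B t→t′
  ... | u′ , u→u′ , Tu′t′ with R.back Rsu c∈B u→u′
  ... | s′ , s→s′ , Rs′u′ = s′ , s→s′ , u′ , Rs′u′ , Tu′t′

-- `init p` is related to two states: the fresh `nothing`, and its own copy in the sum, which is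
-- where `p` arrives if it ever returns to `init p`.
data Injectionˡ {A : Set ℓ} (p q : Process A) : REL (State p) (State (p + q)) ℓ where
  start  : Injectionˡ p q (init p) nothing
  inside : ∀ {s} → Injectionˡ p q s (just (inj₁ s))

-- Each step of `p` survives in the sum and leads into the left copy. The steps that `q` adds at
-- `nothing` would have to be matched only by `back`, which is vacuous for empty `B`.
p≲p+q : {B : Pred A ℓ} → Empty B → (p q : Process A) → p ≲[ B ] (p + q)
p≲p+q B-empty p q = Injectionˡ p q , record
  { forth = λ where
      start  s→s′ → _ , chooseˡ s→s′ , inside
      inside s→s′ → _ , insideˡ s→s′ , inside
  ; back = λ _ c∈B _ → contradiction c∈B (B-empty _)
  } , start

-- Transitions are membership proofs: `Poly.∅` gives the inert process, and `refl` is a step of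
-- `selfLoops ｛ b ｝`.
selfLoops : {A : Set ℓ} → Pred A ℓ → Process A
selfLoops C = record
  { lts  = record { State = ⊤ ; _—[_]→_ = λ _ c _ → c ∈ C }
  ; init = tt
  }

p≴cc-p+q : (S : Signature A) {b : A} → b ∈ Signature.Aˡ S →
           ¬ (selfLoops Poly.∅ ≲cc[ S ] (selfLoops Poly.∅ + selfLoops ｛ b ｝))
p≴cc-p+q S b∈Aˡ (R , R-sim , Rpq)
  with IsCCSimulation.back R-sim Rpq (inj₁ b∈Aˡ) (chooseʳ refl)
-- The matching step of the inert process would be a proof of `b ∈ Poly.∅`.
... | _ , () , _

proposition20 : ∀ {ℓ ℓ′ : Level} {A : Set ℓ} (S : Signature A) {a b : A} →
    a ∈ Signature.Aʳ S → b ∈ Signature.Aˡ S →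
    (A′ : Set ℓ′) (B : Pred A′ ℓ′) → B ≐ ∅ →
    ¬ (Σ[ 𝒯 ∈ (Process A → Process A′) ]
    (∀ p q → (p ≲cc[ S ] q) ⇔ (𝒯 p ≲[ B ] 𝒯 q)) ×
    (∀ p q → 𝒯 (p + q) ≈[ B ] (𝒯 p + 𝒯 q)))
proposition20 S {b = b} _ b∈Aˡ A′ B B≐∅ (𝒯 , ≲cc⇔≲ , 𝒯-+) =
  -- Condition (1) is read from right to left, reflecting the chain of translated processes back to
  -- `≲cc`.
  p≴cc-p+q S b∈Aˡ (Equivalence.from (≲cc⇔≲ p (p + q))
    (≲-trans (𝒯 p) (𝒯 p + 𝒯 q) (𝒯 (p + q))
      (p≲p+q (λ _ → proj₁ B≐∅) (𝒯 p) (𝒯 q))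
      -- This half of the homomorphism condition is `𝒯 p + 𝒯 q ≲[ B ] 𝒯 (p + q)`.
      (SymInterior.rhs≤lhs (𝒯-+ p q))))
  where
  p = selfLoops Poly.∅
  q = selfLoops ｛ b ｝
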